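{- Let $t\ge 2$ and $\ell \ge 1$ be fixed integers. Then \[ \mathscr{I}(W_{2t+1}) \le \frac{\alpha(W_{2t+1}^{\Box \ell}\Box K_3)}{3(2t+2)^{\ell}}.\]
   Context: All graphs are finite and simple. $W_{n}$ denotes the $n$-wheel, the join of the cycle $C_{n}$ with a single vertex $K_1$ (so $W_{2t+1}$ has $2t+2$ vertices). The Cartesian product $G \Box H$ has vertex set $V(G)\times V(H)$, with $(u,x)$ adjacent to $(v,y)$ if and only if either $u=v$ and $xy\in E(H)$, or $x=y$ and $uv\in E(G)$. Set $G^{\Box 1}=G$ and $G^{\Box k}=G^{\Box (k-1)}\Box G$ for $k\ge 2$. $\alpha(G)$ is the independence number of $G$, and $K_3$ is the complete graph on $3$ vertices. The independence ratio is $i(G)=\alpha(G)/|V(G)|$, and the ultimate independence ratio is $\mathscr{I}(G)=\lim_{m\to\infty} i(G^{\Box m})$; this limit exists because $i(G^{\Box (m+1)})\le i(G^{\Box m})$ for all $m$. -}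

module Defs where

open import Data.Bool.Base using (Bool; true; false)
open import Data.Empty using (⊥-elim)
open import Data.Fin.Base using (Fin; zero; suc; toℕ; combine; _↑ˡ_; _↑ʳ_)
import Data.Fin.Properties as Fin
open import Data.Fin.Subset using (Subset; inside; outside; _∈_; ∣_∣; ⊥)
open import Data.Fin.Subset.Properties using (_∈?_; ∉⊥)
open import Data.Integer.Base using (+_)
import Data.Integer.Base as ℤ
import Data.Integer.Properties as ℤ
open import Data.List.Base using (List; []; _∷_; _++_; map; filter)
open import Data.List.Extrema.Nat using (max; xs≤max; argmax-sel)
open import Data.List.Membership.Propositional using () renaming (_∈_ to _∈ˡ_)
open import Data.List.Membership.Propositional.Properties
  using (∈-++⁺ˡ; ∈-++⁺ʳ; ∈-map⁺; ∈-map⁻; ∈-filter⁺; ∈-filter⁻)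
open import Data.List.Relation.Unary.All using () renaming (lookup to All-lookup)
open import Data.List.Relation.Unary.Any using (here)
open import Data.Nat.Base as ℕ using (ℕ; zero; suc; NonZero)
import Data.Nat.Properties as ℕ
open import Data.Product.Base using (∃; _×_; _,_; proj₁; proj₂)
open import Data.Product.Function.NonDependent.Propositional using (_×-↔_)
open import Data.Rational.Base
  using (ℚ; _/_; _<_; _≤_; _+_; _-_; _*_; -_; 1/_; 0ℚ; 1ℚ; Positive; positive)
import Data.Rational.Base as ℚ
import Data.Rational.Properties as ℚ
import Algebra.Properties.Group ℚ.+-0-group as ℚ-Group
open import Data.Rational.Unnormalised.Base using (mkℚᵘ)
import Data.Rational.Unnormalised.Base as ℚᵘ
import Data.Rational.Unnormalised.Properties as ℚᵘ
open import Data.Sum.Base using (_⊎_; inj₁; inj₂)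
open import Data.Sum.Function.Propositional using (_⊎-↔_)
open import Data.Unit.Base using (⊤; tt)
open import Data.Vec.Base using ([]; _∷_; lookup; tabulate)
import Data.Vec.Properties as Vec
open import Function.Base using (_∘_)
open import Function.Bundles using (_↔_; Inverse)
open import Function.Construct.Composition using (_↔-∘_)
open import Function.Construct.Identity using (↔-id)
open import Level using (0ℓ)
open import Relation.Binary.Core using (Rel)
open import Relation.Binary.Definitions
  using (Decidable; DecidableEquality; Symmetric; tri<; tri≈; tri>)
open import Relation.Binary.PropositionalEquality
  using (_≡_; _≢_; refl; sym; trans; cong; subst; subst₂)
open import Relation.Nullary using (¬_; Dec; yes; no)
open import Relation.Nullary.Decidable using (_×-dec_; _⊎-dec_; _→-dec_; ¬?; map′)
open import Relation.Unary using (Pred; _⊆_)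
open import Algebra.Properties.CommutativeMonoid.Sum ℕ.+-0-commutativeMonoid
  using (sum; ∑-comm; sum-cong-≗)

------------------------------------------------------------------------
-- Finite simple graphs

-- Finiteness is an enumeration of the vertices; adjacency on a finite
-- graph is taken to be decidable.
record Graph : Set₁ where
  field
    Vertex : Set
    order  : ℕ
    enum   : Fin order ↔ Vertex
    Adj    : Rel Vertex 0ℓ
    adj?   : Decidable Adj
    symm   : Symmetric Adj
    irrefl : ∀ {v} → ¬ Adj v v

  vertex : Fin order → Vertex
  vertex = Inverse.to enum

  index : Vertex → Fin order
  index = Inverse.from enum

  _≟_ : DecidableEquality Vertex
  u ≟ v = map′
    (λ eq → trans (sym (Inverse.strictlyInverseˡ enum u))
                  (trans (cong vertex eq) (Inverse.strictlyInverseˡ enum v)))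
    (cong index)
    (index u Fin.≟ index v)

open Graph using (order)

K : ℕ → Graph
K n = record
  { Vertex = Fin n
  ; order  = n
  ; enum   = ↔-id (Fin n)
  ; Adj    = _≢_
  ; adj?   = λ i j → ¬? (i Fin.≟ j)
  ; symm   = λ i≢j → i≢j ∘ sym
  ; irrefl = λ v≢v → v≢v refl
  }

-- j is the cyclic successor of i in 0, 1, …, n-1.
Next : ∀ {n} → Rel (Fin n) 0ℓ
Next {n} i j = (toℕ j ≡ suc (toℕ i)) ⊎ (suc (toℕ i) ≡ n × toℕ j ≡ 0)

next? : ∀ {n} → Decidable (Next {n})
next? {n} i j =
  (toℕ j ℕ.≟ suc (toℕ i)) ⊎-dec ((suc (toℕ i) ℕ.≟ n) ×-dec (toℕ j ℕ.≟ 0))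

-- The cycle on n vertices for n ≥ 3. The condition i ≢ j only matters for
-- n = 1, where it excludes the loop.
C : ℕ → Graph
C n = record
  { Vertex = Fin n
  ; order  = n
  ; enum   = ↔-id (Fin n)
  ; Adj    = λ i j → i ≢ j × (Next i j ⊎ Next j i)
  ; adj?   = λ i j → ¬? (i Fin.≟ j) ×-dec (next? i j ⊎-dec next? j i)
  ; symm   = λ { (i≢j , inj₁ p) → (i≢j ∘ sym) , inj₂ p
               ; (i≢j , inj₂ p) → (i≢j ∘ sym) , inj₁ p }
  ; irrefl = λ { (v≢v , _) → v≢v refl }
  }

infixl 8 _^□_

module _ (G H : Graph) where
  infixr 6 _∇_
  infixl 7 _□_

  private
    module G = Graph G
    module H = Graph H

  JoinAdj : Rel (G.Vertex ⊎ H.Vertex) 0ℓ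
  JoinAdj (inj₁ u) (inj₁ v) = G.Adj u v
  JoinAdj (inj₁ u) (inj₂ y) = ⊤
  JoinAdj (inj₂ x) (inj₁ v) = ⊤
  JoinAdj (inj₂ x) (inj₂ y) = H.Adj x y

  _∇_ : Graph
  _∇_ = record
    { Vertex = G.Vertex ⊎ H.Vertex
    ; order  = G.order ℕ.+ H.order
    ; enum   = (G.enum ⊎-↔ H.enum) ↔-∘ Fin.+↔⊎
    ; Adj    = JoinAdj
    ; adj?   = λ { (inj₁ u) (inj₁ v) → G.adj? u v
                 ; (inj₁ u) (inj₂ y) → yes tt
                 ; (inj₂ x) (inj₁ v) → yes tt
                 ; (inj₂ x) (inj₂ y) → H.adj? x y }
    ; symm   = λ { {inj₁ u} {inj₁ v} → G.symm
                 ; {inj₁ u} {inj₂ y} → λ _ → tt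
                 ; {inj₂ x} {inj₁ v} → λ _ → tt
                 ; {inj₂ x} {inj₂ y} → H.symm }
    ; irrefl = λ { {inj₁ u} → G.irrefl ; {inj₂ x} → H.irrefl }
    }

  ProductAdj : Rel (G.Vertex × H.Vertex) 0ℓ
  ProductAdj (u , x) (v , y) = (u ≡ v × H.Adj x y) ⊎ (x ≡ y × G.Adj u v)

  _□_ : Graph
  _□_ = record
    { Vertex = G.Vertex × H.Vertex
    ; order  = G.order ℕ.* H.order
    ; enum   = (G.enum ×-↔ H.enum) ↔-∘ Fin.*↔×
    ; Adj    = ProductAdj
    ; adj?   = λ { (u , x) (v , y) → ((u G.≟ v) ×-dec H.adj? x y)
                                  ⊎-dec ((x H.≟ y) ×-dec G.adj? u v) }
    ; symm   = λ { (inj₁ (u≡v , xy)) → inj₁ (sym u≡v , H.symm xy)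
                 ; (inj₂ (x≡y , uv)) → inj₂ (sym x≡y , G.symm uv) }
    ; irrefl = λ { (inj₁ (_ , xx)) → H.irrefl xx
                 ; (inj₂ (_ , uu)) → G.irrefl uu }
    }

W : ℕ → Graph
W n = C n ∇ K 1

_^□_ : Graph → (k : ℕ) → .{{NonZero k}} → Graph
G ^□ 1             = G
G ^□ suc (suc k)   = G ^□ suc k □ G

------------------------------------------------------------------------
-- Independence number

subsets : ∀ n → List (Subset n)
subsets zero    = [] ∷ []
subsets (suc n) = map (inside ∷_) (subsets n) ++ map (outside ∷_) (subsets n)

∈-subsets : ∀ {n} (S : Subset n) → S ∈ˡ subsets n
∈-subsets []          = here refl
∈-subsets {suc n} (true ∷ S)  = ∈-++⁺ˡ (∈-map⁺ (inside ∷_) (∈-subsets S))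
∈-subsets {suc n} (false ∷ S) =
  ∈-++⁺ʳ (map (inside ∷_) (subsets n)) (∈-map⁺ (outside ∷_) (∈-subsets S))

module _ (G : Graph) where
  open Graph G hiding (order)

  Independent : Subset (order G) → Set
  Independent S = ∀ i j → i ∈ S → j ∈ S → ¬ Adj (vertex i) (vertex j)

  independent? : ∀ S → Dec (Independent S)
  independent? S = Fin.all? λ i → Fin.all? λ j →
    (i ∈? S) →-dec ((j ∈? S) →-dec ¬? (adj? (vertex i) (vertex j)))

  -- The default 0 is the size of the empty set, which is independent.
  α : ℕ
  α = max 0 (map ∣_∣ (filter independent? (subsets (order G))))

  ∣S∣≤α : ∀ {S} → Independent S → ∣ S ∣ ℕ.≤ α
  ∣S∣≤α {S} ind = All-lookup (xs≤max 0 _)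
    (∈-map⁺ ∣_∣ (∈-filter⁺ independent? (∈-subsets S) ind))

  α-attained : ∃ λ S → Independent S × ∣ S ∣ ≡ α
  α-attained with argmax-sel (λ n → n) 0 (map ∣_∣ (filter independent? (subsets (order G))))
  ... | inj₁ α≡0 = ⊥ , (λ i j i∈⊥ → ⊥-elim (∉⊥ i∈⊥)) , trans (∣⊥∣≡0 (order G)) (sym α≡0)
    where open import Data.Fin.Subset.Properties using (∣⊥∣≡0)
  ... | inj₂ α∈ with ∈-map⁻ ∣_∣ α∈
  ...   | S , S∈ , α≡ = S , proj₂ (∈-filter⁻ independent? {xs = subsets (order G)} S∈) , sym α≡

------------------------------------------------------------------------
-- α (G □ H) ≤ α G * ∣V(H)∣, from the copies of G in G □ H

bit : Bool → ℕ
bit true  = 1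
bit false = 0

∣∣-sum : ∀ {n} (S : Subset n) → ∣ S ∣ ≡ sum (bit ∘ lookup S)
∣∣-sum []          = refl
∣∣-sum (true ∷ S)  = cong suc (∣∣-sum S)
∣∣-sum (false ∷ S) = ∣∣-sum S

sum-++ : ∀ m {n} (f : Fin (m ℕ.+ n) → ℕ) →
         sum f ≡ sum (λ i → f (i ↑ˡ n)) ℕ.+ sum (λ j → f (m ↑ʳ j))
sum-++ zero    f = refl
sum-++ (suc m) f = trans (cong (f zero ℕ.+_) (sum-++ m (f ∘ suc)))
                         (sym (ℕ.+-assoc (f zero) _ _))

sum-combine : ∀ m {n} (f : Fin (m ℕ.* n) → ℕ) →
              sum f ≡ sum (λ i → sum (λ j → f (combine {m} {n} i j)))
sum-combine zero        f = refl
sum-combine (suc m) {n} f = trans (sum-++ n f)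
  (cong (sum (λ j → f (j ↑ˡ (m ℕ.* n))) ℕ.+_) (sum-combine m (λ k → f (n ↑ʳ k))))

sum-≤ : ∀ {n} c (f : Fin n → ℕ) → (∀ i → f i ℕ.≤ c) → sum f ℕ.≤ n ℕ.* c
sum-≤ {zero}  c f f≤c = ℕ.z≤n
sum-≤ {suc n} c f f≤c = ℕ.+-mono-≤ (f≤c zero) (sum-≤ c (f ∘ suc) (f≤c ∘ suc))

fibre : ∀ {m n} → Subset (m ℕ.* n) → Fin n → Subset m
fibre S j = tabulate λ i → lookup S (combine i j)

∣S∣≡∑∣fibre∣ : ∀ {m n} (S : Subset (m ℕ.* n)) → ∣ S ∣ ≡ sum (λ j → ∣ fibre {m} S j ∣)
∣S∣≡∑∣fibre∣ {m} {n} S = trans (∣∣-sum S) (trans (sum-combine m _)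
  (trans (∑-comm {m} {n} (λ i j → bit (lookup S (combine i j))))
    (sum-cong-≗ {n} λ j → trans
      (sum-cong-≗ {m} λ i → cong bit (sym (Vec.lookup∘tabulate (λ i → lookup S (combine i j)) i)))
      (sym (∣∣-sum (fibre {m} S j))))))

fibre-independent : ∀ G H {S} → Independent (G □ H) S →
                    ∀ j → Independent G (fibre {order G} S j)
fibre-independent G H {S} ind j i i′ i∈ i′∈ adj =
  ind (combine i j) (combine i′ j) (∈S i i∈) (∈S i′ i′∈)
    (subst₂′ (vertex-combine i) (vertex-combine i′) (inj₂ (refl , adj)))
  where
  module G = Graph G
  module H = Graph H
  ∈S : ∀ k → k ∈ fibre {order G} S j → combine k j ∈ S
  ∈S k k∈ = Vec.lookup⇒[]= (combine k j) S
    (trans (sym (Vec.lookup∘tabulate (λ i → lookup S (combine i j)) k)) (Vec.[]=⇒lookup k∈))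
  vertex-combine : ∀ k → (G.vertex k , H.vertex j) ≡ Graph.vertex (G □ H) (combine k j)
  vertex-combine k =
    cong (λ { (a , b) → G.vertex a , H.vertex b }) (sym (Fin.remQuot-combine k j))
  subst₂′ : ∀ {p q p′ q′} → p ≡ p′ → q ≡ q′ → ProductAdj G H p q → ProductAdj G H p′ q′
  subst₂′ refl refl a = a

α-□ : ∀ G H → α (G □ H) ℕ.≤ order H ℕ.* α G
α-□ G H with α-attained (G □ H)
... | S , ind , ∣S∣≡α = subst (ℕ._≤ _) (trans (sym (∣S∣≡∑∣fibre∣ {order G} S)) ∣S∣≡α)
  (sum-≤ (α G) _ λ j → ∣S∣≤α G (fibre-independent G H ind j))

------------------------------------------------------------------------
-- Real numbers

-- Dedekind cuts in the rationals. Locatedness carries a double negation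
-- (classically void), because the limit of a decreasing sequence of
-- rationals is in general not located constructively.
record ℝ : Set₁ where
  field
    lower upper : Pred ℚ 0ℓ
    lower-inhabited : ∃ lower
    upper-inhabited : ∃ upper
    lower-down  : ∀ {p q} → p < q → lower q → lower p
    lower-open  : ∀ {p} → lower p → ∃ λ q → p < q × lower q
    upper-up    : ∀ {p q} → p < q → upper p → upper q
    upper-open  : ∀ {q} → upper q → ∃ λ p → p < q × upper p
    disjoint    : ∀ {q} → lower q → ¬ upper q
    located     : ∀ {p q} → p < q → ¬ ¬ (lower p ⊎ upper q)

open ℝ public using (lower; upper)

infix 4 _≤ᴿ_

-- Classically either component implies the other.
_≤ᴿ_ : Rel ℝ 0ℓ
x ≤ᴿ y = (lower x ⊆ lower y) × (upper y ⊆ upper x)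

p-1<p : ∀ p → p - 1ℚ < p
p-1<p p = subst (p - 1ℚ <_) (ℚ.+-identityʳ p) (ℚ.+-monoʳ-< p (ℚ.negative⁻¹ (- 1ℚ)))

p<p+ε : ∀ p {ε} → 0ℚ < ε → p < p + ε
p<p+ε p {ε} 0<ε = subst (_< p + ε) (ℚ.+-identityʳ p) (ℚ.+-monoʳ-< p 0<ε)

p<p+1 : ∀ p → p < p + 1ℚ
p<p+1 p = p<p+ε p (ℚ.positive⁻¹ 1ℚ)

fromℚ : ℚ → ℝ
fromℚ r = record
  { lower           = _< r
  ; upper           = r <_
  ; lower-inhabited = r - 1ℚ , p-1<p r
  ; upper-inhabited = r + 1ℚ , p<p+1 r
  ; lower-down      = ℚ.<-trans
  ; lower-open      = λ p<r → let q , p<q , q<r = ℚ.<-dense p<r in q , p<q , q<r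
  ; upper-up        = λ p<q r<p → ℚ.<-trans r<p p<q
  ; upper-open      = λ r<q → let p , r<p , p<q = ℚ.<-dense r<q in p , p<q , r<p
  ; disjoint        = λ q<r r<q → ℚ.<-asym q<r r<q
  ; located         = λ {p} {q} p<q k → k (cut p<q)
  }
  where
  cut : ∀ {p q} → p < q → (p < r) ⊎ (r < q)
  cut {p} {q} p<q with ℚ.<-cmp p r
  ... | tri< p<r _ _  = inj₁ p<r
  ... | tri≈ _ refl _ = inj₂ p<q
  ... | tri> _ _ r<p  = inj₂ (ℚ.<-trans r<p p<q)

toℚᵘ-/ : ∀ m d .{{_ : NonZero d}} → ℚ.toℚᵘ (+ m / d) ℚᵘ.≃ (+ m ℚᵘ./ d)
toℚᵘ-/ m (suc d) = ℚ.toℚᵘ-fromℚᵘ (mkℚᵘ (+ m) d)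

/-mono-≤ : ∀ m d m′ d′ .{{_ : NonZero d}} .{{_ : NonZero d′}} →
           m ℕ.* d′ ℕ.≤ m′ ℕ.* d → + m / d ≤ + m′ / d′
/-mono-≤ m d@(suc _) m′ d′@(suc _) md′≤m′d = ℚ.toℚᵘ-cancel-≤
  (ℚᵘ.≤-trans (ℚᵘ.≤-reflexive (toℚᵘ-/ m d)) (ℚᵘ.≤-trans
    (ℚᵘ.*≤* (subst₂ ℤ._≤_ (ℤ.pos-* m d′) (ℤ.pos-* m′ d) (ℤ.+≤+ md′≤m′d)))
    (ℚᵘ.≤-reflexive (ℚᵘ.≃-sym (toℚᵘ-/ m′ d′)))))

suc/1 : ∀ k → + suc k / 1 ≡ + k / 1 + 1ℚ
suc/1 k = ℚ.toℚᵘ-injective (ℚᵘ.≃-trans (toℚᵘ-/ (suc k) 1) (ℚᵘ.≃-sym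
  (ℚᵘ.≃-trans (ℚ.toℚᵘ-homo-+ (+ k / 1) 1ℚ) (ℚᵘ.≃-trans
    (ℚᵘ.+-congˡ ℚᵘ.1ℚᵘ (toℚᵘ-/ k 1))
    (ℚᵘ.*≡* (cong (ℤ._* + 1)
      (trans (cong (ℤ._+ + 1) (ℤ.*-identityʳ (+ k))) (cong +_ (ℕ.+-comm k 1)))))))))

archimedean : ∀ x → ∃ λ k → x < + k / 1
archimedean x@(ℚ.mkℚ n d-1 _) = suc ℤ.∣ n ∣ , ℚ.toℚᵘ-cancel-<
  (ℚᵘ.<-≤-trans (ℚᵘ.*<* n*1<k*d) (ℚᵘ.≤-reflexive (ℚᵘ.≃-sym (toℚᵘ-/ (suc ℤ.∣ n ∣) 1))))
  where
  n*1<k*d : n ℤ.* + 1 ℤ.< + suc ℤ.∣ n ∣ ℤ.* + suc d-1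
  n*1<k*d = subst₂ ℤ._<_ (sym (ℤ.*-identityʳ n)) (ℤ.pos-* (suc ℤ.∣ n ∣) (suc d-1))
    (ℤ.≤-<-trans (n≤∣n∣ n) (ℤ.+<+ (ℕ.m≤m*n (suc ℤ.∣ n ∣) (suc d-1))))
    where
    n≤∣n∣ : ∀ i → i ℤ.≤ + ℤ.∣ i ∣
    n≤∣n∣ (+ _)      = ℤ.≤-refl
    n≤∣n∣ ℤ.-[1+ _ ] = ℤ.-≤+

Eventually : Pred ℕ 0ℓ → Set
Eventually P = ∃ λ N → ∀ n → N ℕ.≤ n → P n

-- p < lim a (resp. lim a < q) iff a is eventually bounded away from p above
-- it (resp. from q below it).
module Limit (a : ℕ → ℚ) (decreasing : ∀ n → a (suc n) ≤ a n)
             (b : ℚ) (bounded : ∀ n → b ≤ a n) where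

  antitone : ∀ {m n} → m ℕ.≤ n → a n ≤ a m
  antitone {m} m≤n = go (ℕ.≤⇒≤′ m≤n)
    where
    go : ∀ {n} → m ℕ.≤′ n → a n ≤ a m
    go ℕ.≤′-refl      = ℚ.≤-refl
    go (ℕ.≤′-step m≤n) = ℚ.≤-trans (decreasing _) (go m≤n)

  Below Above : Pred ℚ 0ℓ
  Below p = ∃ λ p′ → p < p′ × Eventually λ n → p′ ≤ a n
  Above q = ∃ λ q′ → q′ < q × Eventually λ n → a n ≤ q′

  below-or-above : ∀ {p q} → p < q → ¬ Above q → Below p
  below-or-above {p} {q} p<q ¬above = q , p<q , 0 , λ n _ → ℚ.≮⇒≥ λ aₙ<q →
    ¬above (a n , aₙ<q , n , λ m n≤m → antitone n≤m)

  lim : ℝ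
  lim = record
    { lower           = Below
    ; upper           = Above
    ; lower-inhabited = b - 1ℚ , b , p-1<p b , 0 , λ n _ → bounded n
    ; upper-inhabited = a 0 + 1ℚ , a 0 , p<p+1 (a 0) , 0 , λ n _ → antitone ℕ.z≤n
    ; lower-down      = λ p<q (p′ , q<p′ , ev) → p′ , ℚ.<-trans p<q q<p′ , ev
    ; lower-open      = λ (p′ , p<p′ , ev) →
        let q , p<q , q<p′ = ℚ.<-dense p<p′ in q , p<q , p′ , q<p′ , ev
    ; upper-up        = λ p<q (q′ , q′<p , ev) → q′ , ℚ.<-trans q′<p p<q , ev
    ; upper-open      = λ (q′ , q′<q , ev) →
        let p , q′<p , p<q = ℚ.<-dense q′<q in p , p<q , q′ , q′<p , ev
    ; disjoint        = λ (p′ , q<p′ , M , p′≤a) (q′ , q′<q , N , a≤q′) →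
        ℚ.<-irrefl refl (ℚ.<-≤-trans (ℚ.<-trans q′<q q<p′)
          (ℚ.≤-trans (p′≤a (M ℕ.⊔ N) (ℕ.m≤m⊔n M N)) (a≤q′ (M ℕ.⊔ N) (ℕ.m≤n⊔m M N))))
    ; located         = λ p<q k → k (inj₁ (below-or-above p<q (k ∘ inj₂)))
    }

  -- lim is the limit of a, up to the double negation that comes from the
  -- missing rate of convergence.
  lim-converges : ∀ {ε} → 0ℚ < ε →
    ¬ ¬ Eventually λ n → lower lim (a n - ε) × upper lim (a n + ε)
  lim-converges {ε} 0<ε notConv = let k , x<k = archimedean (x * 1/δ) in
    descend k λ (M , aₘ≤) → ℚ.<-irrefl refl (ℚ.<-≤-trans (a₀-kδ<b k x<k)
      (ℚ.≤-trans (bounded M) aₘ≤))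
    where
    δ x : ℚ
    δ = proj₁ (ℚ.<-dense 0<ε)
    x = a 0 - b
    0<δ : 0ℚ < δ
    0<δ = proj₁ (proj₂ (ℚ.<-dense 0<ε))
    δ<ε : δ < ε
    δ<ε = proj₂ (proj₂ (ℚ.<-dense 0<ε))
    instance
      δ-positive : Positive δ
      δ-positive = positive 0<δ
      δ-nonZero : ℚ.NonZero δ
      δ-nonZero = ℚ.pos⇒nonZero δ
    1/δ : ℚ
    1/δ = 1/ δ

    notBelow : ∀ N → ¬ Below (a N - ε)
    notBelow N (p′ , p<p′ , ev) = notConv (N , λ n N≤n →
      (p′ , ℚ.≤-<-trans (ℚ.+-monoˡ-≤ (- ε) (antitone N≤n)) p<p′ , ev) ,
      (a n , p<p+ε (a n) 0<ε , n , λ m n≤m → antitone n≤m))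

    drop : ∀ N → ¬ ¬ ∃ λ M → a M ≤ a N - δ
    drop N k = notBelow N (below-or-above (ℚ.+-monoʳ-< (a N) (ℚ.neg-antimono-< δ<ε))
      λ (q′ , q′<q , M , a≤q′) → k (M , ℚ.≤-trans (a≤q′ M ℕ.≤-refl) (ℚ.<⇒≤ q′<q)))

    step : ∀ k → a 0 - (+ k / 1) * δ - δ ≡ a 0 - (+ suc k / 1) * δ
    step k rewrite suc/1 k | ℚ.*-distribʳ-+ δ (+ k / 1) 1ℚ | ℚ.*-identityˡ δ
      | ℚ.neg-distrib-+ ((+ k / 1) * δ) δ = ℚ.+-assoc (a 0) (- ((+ k / 1) * δ)) (- δ)

    descend : ∀ k → ¬ ¬ ∃ λ M → a M ≤ a 0 - (+ k / 1) * δ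
    descend zero none = none (0 , ℚ.≤-reflexive
      (sym (trans (cong (λ z → a 0 - z) (ℚ.*-zeroˡ δ)) (ℚ.+-identityʳ (a 0)))))
    descend (suc k) none = descend k λ (N , aN≤) → drop N λ (M , aM≤) →
      none (M , ℚ.≤-trans aM≤ (ℚ.≤-trans (ℚ.+-monoˡ-≤ (- δ) aN≤) (ℚ.≤-reflexive (step k))))

    cancel : x * 1/δ * δ ≡ x
    cancel = trans (ℚ.*-assoc x 1/δ δ)
      (trans (cong (x *_) (ℚ.*-inverseˡ δ)) (ℚ.*-identityʳ x))

    a₀-x : a 0 - x ≡ b
    a₀-x = trans (cong (λ z → a 0 + z) (trans (ℚ.neg-distrib-+ (a 0) (- b))
                   (cong (λ z → - a 0 + z) (ℚ-Group.⁻¹-involutive b))))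
           (trans (sym (ℚ.+-assoc (a 0) (- a 0) b))
           (trans (cong (_+ b) (ℚ.+-inverseʳ (a 0))) (ℚ.+-identityˡ b)))

    a₀-kδ<b : ∀ k → x * 1/δ < + k / 1 → a 0 - (+ k / 1) * δ < b
    a₀-kδ<b k x<k = subst (a 0 - (+ k / 1) * δ <_) a₀-x (ℚ.+-monoʳ-< (a 0) (ℚ.neg-antimono-<
      (subst (_< (+ k / 1) * δ) cancel (ℚ.*-monoˡ-<-pos δ x<k))))

------------------------------------------------------------------------
-- Independence ratios

independenceRatio : (G : Graph) → .{{NonZero (order G)}} → ℚ
independenceRatio G = + α G / order G

order-^□≢0 : ∀ G k .{{_ : NonZero k}} → .{{NonZero (order G)}} → NonZero (order (G ^□ k))
order-^□≢0 G 1             {{_}} {{nz}} = ℕ.≢-nonZero (ℕ.≢-nonZero⁻¹ (order G) {{nz}})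
order-^□≢0 G (suc (suc k)) = ℕ.m*n≢0 (order (G ^□ suc k)) (order G) {{order-^□≢0 G (suc k)}}

module _ (G : Graph) .{{_ : NonZero (order G)}} where

  powerRatio : (k : ℕ) → .{{NonZero k}} → ℚ
  powerRatio k = independenceRatio (G ^□ k) {{order-^□≢0 G k}}

  powerRatio-decreasing : ∀ m → powerRatio (suc (suc m)) ≤ powerRatio (suc m)
  powerRatio-decreasing m = /-mono-≤ (α (P □ G)) (order (P □ G)) (α P) (order P)
    {{order-^□≢0 G (suc (suc m))}} {{order-^□≢0 G (suc m)}}
    (begin
      α (P □ G) ℕ.* order P             ≤⟨ ℕ.*-monoˡ-≤ (order P) (α-□ P G) ⟩
      order G ℕ.* α P ℕ.* order P       ≡⟨ cong (ℕ._* order P) (ℕ.*-comm (order G) (α P)) ⟩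
      α P ℕ.* order G ℕ.* order P       ≡⟨ ℕ.*-assoc (α P) (order G) (order P) ⟩
      α P ℕ.* (order G ℕ.* order P)     ≡⟨ cong (α P ℕ.*_) (ℕ.*-comm (order G) (order P)) ⟩
      α P ℕ.* (order P ℕ.* order G)     ∎)
    where
    P = G ^□ suc m
    open ℕ.≤-Reasoning

  0≤powerRatio : ∀ m → 0ℚ ≤ powerRatio (suc m)
  0≤powerRatio m = /-mono-≤ 0 1 (α (G ^□ suc m)) (order (G ^□ suc m))
    {{_}} {{order-^□≢0 G (suc m)}} ℕ.z≤n

  ℐ : ℝ
  ℐ = Limit.lim (λ m → powerRatio (suc m)) powerRatio-decreasing 0ℚ 0≤powerRatio

3[2t+2]^ℓ≢0 : ∀ t ℓ → NonZero (3 ℕ.* (2 ℕ.* t ℕ.+ 2) ℕ.^ ℓ)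
3[2t+2]^ℓ≢0 t ℓ = ℕ.m*n≢0 3 _ {{_}}
  {{ℕ.m^n≢0 (2 ℕ.* t ℕ.+ 2) ℓ {{ℕ.≢-nonZero λ eq → ℕ.1+n≢0 (ℕ.m+n≡0⇒n≡0 (2 ℕ.* t) eq)}}}}

{-# OPTIONS --safe #-}

-- Let a m = α (G^□m), N = |G| and let F → G be a homomorphism. Each fibre of a
-- maximum independent set of G^□m □ G has at most a m elements, so each has at
-- least a (m+1) - (N-1) a m. The fibres over the image of F form an independent
-- set of G^□m □ F, hence
--   |F| (a (m+1) - (N-1) a m) ≤ α (G^□m □ F) ≤ N^(m-ℓ) α (G^□ℓ □ F).
-- As a m is about ℐ(G) N^m, this gives |F| ℐ(G) N^ℓ ≤ α (G^□ℓ □ F). For the wheel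
-- take F = K₃, mapped to the hub and two consecutive rim vertices.

module Submission where

open import Data.Fin.Base using (Fin; zero; suc; combine)
import Data.Fin.Properties as Fin
open import Data.Fin.Subset using (Subset; _∈_; ∣_∣)
open import Data.Integer.Base using (+_; -[1+_])
import Data.Integer.Base as ℤ
import Data.Integer.Properties as ℤ
open import Data.Nat.Base using (ℕ; zero; suc; pred; NonZero; _≥_; _≤_; _<_; _+_; _*_; _^_; z≤n; s≤s)
import Data.Nat.Base as ℕ
import Data.Nat.Properties as ℕ
open import Data.Nat.Tactic.RingSolver using (solve-∀)
open import Data.Product.Base using (∃; _×_; _,_)
import Data.Product.Base as Product
open import Data.Rational.Base using (ℚ; mkℚ; _/_)
import Data.Rational.Base as ℚ
import Data.Rational.Properties as ℚ
import Data.Rational.Unnormalised.Properties as ℚᵘ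
open import Data.Sum.Base using (inj₁; inj₂)
open import Data.Unit.Base using (tt)
open import Data.Vec.Base using (lookup; tabulate)
import Data.Vec.Properties as Vec
open import Function.Base using (_∘_)
open import Function.Bundles using (_↔_; Inverse; mk↔ₛ′)
open import Function.Construct.Composition using (_↔-∘_)
open import Function.Construct.Symmetry using (↔-sym)
open import Relation.Binary.PropositionalEquality
open import Relation.Nullary using (contradiction)
open import Algebra.Properties.CommutativeMonoid.Sum ℕ.+-0-commutativeMonoid
  using (sum; sum-cong-≗; sum-permute)
open import Defs
open Graph using (Vertex; Adj; order)

-- Pulling back independent sets along homomorphisms.

IsHomomorphism : (G H : Graph) → (Vertex G → Vertex H) → Set
IsHomomorphism G H f = ∀ u v → Adj G u v → Adj H (f u) (f v)

module _ (G H : Graph) (f : Vertex G → Vertex H) where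
  private
    module G = Graph G
    module H = Graph H

  preimage : Subset (order H) → Subset (order G)
  preimage S = tabulate λ i → lookup S (H.index (f (G.vertex i)))

  lookup-preimage : ∀ S i → lookup (preimage S) i ≡ lookup S (H.index (f (G.vertex i)))
  lookup-preimage S = Vec.lookup∘tabulate _

  preimage-independent : IsHomomorphism G H f → ∀ {S} →
                         Independent H S → Independent G (preimage S)
  preimage-independent hom {S} ind i j i∈ j∈ adj =
    ind _ _ (∈S i i∈) (∈S j j∈)
      (subst₂ H.Adj (sym (Inverse.strictlyInverseˡ H.enum _))
        (sym (Inverse.strictlyInverseˡ H.enum _)) (hom _ _ adj))
    where
    ∈S : ∀ i → i ∈ preimage S → H.index (f (G.vertex i)) ∈ S
    ∈S i i∈ = Vec.lookup⇒[]= _ S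
      (trans (sym (lookup-preimage S i)) (Vec.[]=⇒lookup i∈))

-- Up to relabelling, `G` is `H` with some edges removed, so the preimage of an independent set
-- stays independent; bijectivity keeps its size.
α-bijective-hom : ∀ G H (f : Vertex G ↔ Vertex H) →
                  IsHomomorphism G H (Inverse.to f) → α H ≤ α G
α-bijective-hom G H f hom with α-attained H
... | S , ind , ∣S∣≡α = subst (_≤ α G) (trans ∣T∣≡∣S∣ ∣S∣≡α)
  (∣S∣≤α G (preimage-independent G H (Inverse.to f) hom ind))
  where
  T = preimage G H (Inverse.to f) S
  ∣T∣≡∣S∣ : ∣ T ∣ ≡ ∣ S ∣
  ∣T∣≡∣S∣ = begin
    ∣ T ∣                  ≡⟨ ∣∣-sum T ⟩
    sum (bit ∘ lookup T)   ≡⟨ sum-cong-≗ (cong bit ∘ lookup-preimage G H (Inverse.to f) S) ⟩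
    sum (bit ∘ lookup S ∘ Inverse.to π) ≡⟨ sum-permute (bit ∘ lookup S) π ⟨
    sum (bit ∘ lookup S)   ≡⟨ ∣∣-sum S ⟨
    ∣ S ∣                  ∎
    where
    π = ↔-sym (Graph.enum H) ↔-∘ (f ↔-∘ Graph.enum G)
    open ≡-Reasoning

-- Independence numbers and orders of powers.

-- Reordering the factors puts `G` last, where `α-□` can remove it at the cost of `order G`.
α-□-swap : ∀ P G F → α ((P □ G) □ F) ≤ order G * α (P □ F)
α-□-swap P G F = ℕ.≤-trans (α-bijective-hom ((P □ F) □ G) ((P □ G) □ F) swap hom) (α-□ (P □ F) G)
  where
  swap : Vertex ((P □ F) □ G) ↔ Vertex ((P □ G) □ F)
  swap = mk↔ₛ′ (λ ((p , x) , g) → (p , g) , x) (λ ((p , g) , x) → (p , x) , g)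
               (λ _ → refl) (λ _ → refl)
  hom : IsHomomorphism ((P □ F) □ G) ((P □ G) □ F) (Inverse.to swap)
  hom _ _ (inj₁ (refl , gg′))               = inj₂ (refl , inj₁ (refl , gg′))
  hom _ _ (inj₂ (refl , inj₁ (refl , xx′))) = inj₁ (refl , xx′)
  hom _ _ (inj₂ (refl , inj₂ (refl , pp′))) = inj₂ (refl , inj₂ (refl , pp′))

α-^□-□ : ∀ G F l m → α (G ^□ suc (m + l) □ F) ≤ order G ^ m * α (G ^□ suc l □ F)
α-^□-□ G F l zero    = ℕ.≤-reflexive (sym (ℕ.*-identityˡ _))
α-^□-□ G F l (suc m) = begin
  α ((G ^□ suc (m + l) □ G) □ F)                 ≤⟨ α-□-swap (G ^□ suc (m + l)) G F ⟩
  order G * α (G ^□ suc (m + l) □ F)             ≤⟨ ℕ.*-monoʳ-≤ (order G) (α-^□-□ G F l m) ⟩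
  order G * (order G ^ m * α (G ^□ suc l □ F))   ≡⟨ ℕ.*-assoc (order G) _ _ ⟨
  order G ^ suc m * α (G ^□ suc l □ F)           ∎
  where open ℕ.≤-Reasoning

order-^□ : ∀ G l → order (G ^□ suc l) ≡ order G ^ suc l
order-^□ G zero    = sym (ℕ.*-identityʳ _)
order-^□ G (suc l) = trans (cong (_* order G) (order-^□ G l)) (ℕ.*-comm _ (order G))

order-^□-+ : ∀ G l m → order (G ^□ suc (m + l)) ≡ order G ^ m * order (G ^□ suc l)
order-^□-+ G l zero    = sym (ℕ.*-identityˡ _)
order-^□-+ G l (suc m) = begin
  order (G ^□ suc (m + l)) * order G             ≡⟨ ℕ.*-comm _ (order G) ⟩
  order G * order (G ^□ suc (m + l))             ≡⟨ cong (order G *_) (order-^□-+ G l m) ⟩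
  order G * (order G ^ m * order (G ^□ suc l))   ≡⟨ ℕ.*-assoc (order G) _ _ ⟨
  order G ^ suc m * order (G ^□ suc l)           ∎
  where open ≡-Reasoning

-- Sums with bounded terms.

-- The other `n - 1` terms contribute at most `c` each. The extra `c` on the left avoids the
-- truncated subtraction.
sum-≤-term : ∀ {n} c (f : Fin n → ℕ) → (∀ i → f i ≤ c) → ∀ i → sum f + c ≤ f i + n * c
sum-≤-term {suc n} c f f≤c zero = begin
  f zero + sum (f ∘ suc) + c   ≤⟨ ℕ.+-monoˡ-≤ c (ℕ.+-monoʳ-≤ (f zero) (sum-≤ c (f ∘ suc) (f≤c ∘ suc))) ⟩
  f zero + n * c + c           ≡⟨ rearrange (f zero) (n * c) c ⟩
  f zero + (c + n * c)         ∎
  where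
  open ℕ.≤-Reasoning
  rearrange : ∀ x y z → x + y + z ≡ x + (z + y)
  rearrange = solve-∀
sum-≤-term {suc n} c f f≤c (suc i) = begin
  f zero + sum (f ∘ suc) + c     ≡⟨ ℕ.+-assoc (f zero) _ c ⟩
  f zero + (sum (f ∘ suc) + c)   ≤⟨ ℕ.+-mono-≤ (f≤c zero) (sum-≤-term c (f ∘ suc) (f≤c ∘ suc) i) ⟩
  c + (f (suc i) + n * c)        ≡⟨ rearrange c (f (suc i)) (n * c) ⟩
  f (suc i) + (c + n * c)        ∎
  where
  open ℕ.≤-Reasoning
  rearrange : ∀ x y z → x + (y + z) ≡ y + (x + z)
  rearrange = solve-∀

sum-≥ : ∀ {n} b e (f : Fin n → ℕ) → (∀ i → b ≤ f i + e) → n * b ≤ sum f + n * e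
sum-≥ {zero}  b e f b≤ = z≤n
sum-≥ {suc n} b e f b≤ = begin
  b + n * b                                 ≤⟨ ℕ.+-mono-≤ (b≤ zero) (sum-≥ b e (f ∘ suc) (b≤ ∘ suc)) ⟩
  (f zero + e) + (sum (f ∘ suc) + n * e)    ≡⟨ rearrange (f zero) e (sum (f ∘ suc)) (n * e) ⟩
  (f zero + sum (f ∘ suc)) + (e + n * e)    ∎
  where
  open ℕ.≤-Reasoning
  rearrange : ∀ x y z w → (x + y) + (z + w) ≡ (x + z) + (y + w)
  rearrange = solve-∀

-- Fibres over the image of a homomorphism.

module _ (P F G : Graph) (g : Vertex F → Vertex G) (g-hom : IsHomomorphism F G g) where
  private
    module F = Graph F
    module G = Graph G
    module P = Graph P

  -- Pull `S` back along the homomorphism `id × g` from `P □ F` to `P □ G`: the fibre of the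
  -- preimage over `x` is the fibre of `S` over `g x`.
  ∑∣fibre∣≤α : ∀ {S} → Independent (P □ G) S →
              sum (λ j → ∣ fibre {order P} S (G.index (g (F.vertex j))) ∣) ≤ α (P □ F)
  ∑∣fibre∣≤α {S} ind = subst (_≤ α (P □ F))
    (trans (∣S∣≡∑∣fibre∣ {order P} T) (sum-cong-≗ (cong ∣_∣ ∘ fibre-T)))
    (∣S∣≤α (P □ F) (preimage-independent (P □ F) (P □ G) f f-hom ind))
    where
    f : Vertex (P □ F) → Vertex (P □ G)
    f = Product.map₂ g
    f-hom : IsHomomorphism (P □ F) (P □ G) f
    f-hom _ _ (inj₁ (p≡q , xy)) = inj₁ (p≡q , g-hom _ _ xy)
    f-hom _ _ (inj₂ (x≡y , pq)) = inj₂ (cong g x≡y , pq)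
    T = preimage (P □ F) (P □ G) f S
    index-f : ∀ i j → Graph.index (P □ G) (f (Graph.vertex (P □ F) (combine i j))) ≡
                      combine i (G.index (g (F.vertex j)))
    index-f i j = trans
      (cong (λ (i , j) → combine (P.index (P.vertex i)) (G.index (g (F.vertex j))))
            (Fin.remQuot-combine i j))
      (cong (λ i → combine i (G.index (g (F.vertex j)))) (Inverse.strictlyInverseʳ P.enum i))
    fibre-T : ∀ j → fibre {order P} T j ≡ fibre {order P} S (G.index (g (F.vertex j)))
    fibre-T j = Vec.tabulate-cong λ i →
      trans (lookup-preimage (P □ F) (P □ G) f S (combine i j)) (cong (lookup S) (index-f i j))

  -- |F| (α (P □ G) - (|G| - 1) α P) ≤ α (P □ F), without subtraction.
  α-□-hom : order F * (α (P □ G) + α P) ≤ α (P □ F) + order F * (order G * α P)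
  α-□-hom with α-attained (P □ G)
  ... | S , ind , ∣S∣≡α = ℕ.≤-trans (sum-≥ _ _ _ λ j → large (G.index (g (F.vertex j))))
                                    (ℕ.+-monoˡ-≤ _ (∑∣fibre∣≤α ind))
    where
    large : ∀ j → α (P □ G) + α P ≤ ∣ fibre {order P} S j ∣ + order G * α P
    large j = subst (λ s → s + α P ≤ ∣ fibre {order P} S j ∣ + order G * α P)
      (trans (sym (∣S∣≡∑∣fibre∣ {order P} S)) ∣S∣≡α)
      (sum-≤-term (α P) _ (λ i → ∣S∣≤α P (fibre-independent P G ind i)) j)

-- Solving the recurrence for the independence numbers.

-- Bernoulli's inequality `(1 + 1/M)^m ≥ m/M` with denominators cleared. It shows that
-- `(M / (M + 1))^m` tends to 0, at rate `M / m`.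
bernoulli : ∀ M m → m * M ^ m ≤ M * suc M ^ m
bernoulli M zero    = z≤n
bernoulli M (suc m) = begin
  M * M ^ m + m * (M * M ^ m)             ≡⟨ rearrange M m (M ^ m) ⟩
  M * (M ^ m + m * M ^ m)                 ≤⟨ ℕ.*-monoʳ-≤ M (ℕ.+-mono-≤ (ℕ.^-monoˡ-≤ m (ℕ.n≤1+n M)) (bernoulli M m)) ⟩
  M * (suc M ^ m + M * suc M ^ m)         ∎
  where
  open ℕ.≤-Reasoning
  rearrange : ∀ x y z → x * z + y * (x * z) ≡ x * (z + y * z)
  rearrange = solve-∀

module _ (a : ℕ → ℕ) (f A M : ℕ)
         (step : ∀ m → f * (a (suc m) + a m) ≤ suc M ^ m * A + f * (suc M * a m)) where

  -- With `N = M + 1`, the sequence `N^m A` solves `x (m+1) = N^m A + M x m`, so by `step` the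
  -- difference `f * a m - N^m A` grows at most by the factor `M` each time. It starts below
  -- `f * a 0`.
  geometric-bound : ∀ m → f * a m ≤ suc M ^ m * A + M ^ m * (f * a 0)
  geometric-bound zero    = begin
    f * a 0               ≡⟨ ℕ.*-identityˡ (f * a 0) ⟨
    1 * (f * a 0)         ≤⟨ ℕ.m≤n+m (1 * (f * a 0)) (1 * A) ⟩
    1 * A + 1 * (f * a 0) ∎
    where open ℕ.≤-Reasoning
  -- Carrying `f * a m` on both sides turns the factor `N` of `step` into `M`.
  geometric-bound (suc m) = ℕ.+-cancelʳ-≤ (f * a m) _ _ (begin
    f * a (suc m) + f * a m                                      ≡⟨ ℕ.*-distribˡ-+ f (a (suc m)) (a m) ⟨
    f * (a (suc m) + a m)                                        ≤⟨ step m ⟩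
    suc M ^ m * A + f * (suc M * a m)                            ≡⟨ rearrange₁ (suc M ^ m * A) f M (a m) ⟩
    suc M ^ m * A + M * (f * a m) + f * a m                      ≤⟨ ℕ.+-monoˡ-≤ (f * a m) (ℕ.+-monoʳ-≤ (suc M ^ m * A) (ℕ.*-monoʳ-≤ M (geometric-bound m))) ⟩
    suc M ^ m * A + M * (suc M ^ m * A + M ^ m * (f * a 0)) + f * a m
      ≡⟨ cong (_+ f * a m) (rearrange₂ (suc M ^ m) A M (M ^ m) (f * a 0)) ⟩
    suc M ^ suc m * A + M ^ suc m * (f * a 0) + f * a m          ∎)
    where
    open ℕ.≤-Reasoning
    rearrange₁ : ∀ x f M y → x + f * (suc M * y) ≡ x + M * (f * y) + f * y
    rearrange₁ = solve-∀
    rearrange₂ : ∀ x A M y B → x * A + M * (x * A + y * B) ≡ suc M * x * A + M * y * B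
    rearrange₂ = solve-∀

  -- After multiplication by `m`, `bernoulli` replaces the error `m * M^m` by a constant multiple of
  -- `N^m`, so that `N^m` factors out.
  linear-bound : ∀ m → m * (f * a m) ≤ suc M ^ m * (m * A + M * (f * a 0))
  linear-bound m = begin
    m * (f * a m)                                     ≤⟨ ℕ.*-monoʳ-≤ m (geometric-bound m) ⟩
    m * (suc M ^ m * A + M ^ m * (f * a 0))           ≡⟨ rearrange₁ m (suc M ^ m) A (M ^ m) (f * a 0) ⟩
    m * (suc M ^ m * A) + m * M ^ m * (f * a 0)       ≤⟨ ℕ.+-monoʳ-≤ (m * (suc M ^ m * A)) (ℕ.*-monoˡ-≤ (f * a 0) (bernoulli M m)) ⟩
    m * (suc M ^ m * A) + M * suc M ^ m * (f * a 0)   ≡⟨ rearrange₂ m (suc M ^ m) A M (f * a 0) ⟩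
    suc M ^ m * (m * A + M * (f * a 0))               ∎
    where
    open ℕ.≤-Reasoning
    rearrange₁ : ∀ m x A y B → m * (x * A + y * B) ≡ m * (x * A) + m * y * B
    rearrange₁ = solve-∀
    rearrange₂ : ∀ m x A M B → m * (x * A) + M * x * B ≡ x * (m * A + M * B)
    rearrange₂ = solve-∀

  -- If A / (f h) < c / b then a m / (N^m h) ≤ c / b for some m, where N = M + 1.
  eventually-≤ : .{{_ : NonZero f}} → ∀ h b c → A * b < c * (f * h) →
                 ∃ λ m → a m * b ≤ c * (suc M ^ m * h)
  eventually-≤ h b c Ab<cfh = m , ℕ.*-cancelˡ-≤ (m * f) {{ℕ.m*n≢0 m f}} (begin
    m * f * (a m * b)                          ≡⟨ rearrange₁ m f (a m) b ⟩
    m * (f * a m) * b                          ≤⟨ ℕ.*-monoˡ-≤ b (linear-bound m) ⟩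
    suc M ^ m * (m * A + M * (f * a 0)) * b    ≡⟨ rearrange₂ (suc M ^ m) m A (M * (f * a 0)) b ⟩
    suc M ^ m * (m * (A * b) + excess)              ≤⟨ ℕ.*-monoʳ-≤ (suc M ^ m) (ℕ.+-monoʳ-≤ (m * (A * b)) (ℕ.n≤1+n excess)) ⟩
    suc M ^ m * (m * (A * b) + m)              ≡⟨ rearrange₃ (suc M ^ m) m (A * b) ⟩
    suc M ^ m * (m * suc (A * b))              ≤⟨ ℕ.*-monoʳ-≤ (suc M ^ m) (ℕ.*-monoʳ-≤ m Ab<cfh) ⟩
    suc M ^ m * (m * (c * (f * h)))            ≡⟨ rearrange₄ (suc M ^ m) m c f h ⟩
    m * f * (c * (suc M ^ m * h))              ∎)
    where
    open ℕ.≤-Reasoning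
    excess m : ℕ
    excess = M * (f * a 0) * b
    -- Strictness of `A * b < c * (f * h)` over the naturals leaves a slack of 1, hence of `m` after
    -- scaling. This `m` absorbs `excess` and is positive, which permits cancelling `m * f`.
    m = suc excess
    rearrange₁ : ∀ m f x b → m * f * (x * b) ≡ m * (f * x) * b
    rearrange₁ = solve-∀
    rearrange₂ : ∀ x m A B b → x * (m * A + B) * b ≡ x * (m * (A * b) + B * b)
    rearrange₂ = solve-∀
    rearrange₃ : ∀ x m y → x * (m * y + m) ≡ x * (m * suc y)
    rearrange₃ = solve-∀
    rearrange₄ : ∀ x m c f h → x * (m * (c * (f * h))) ≡ m * f * (c * (x * h))
    rearrange₄ = solve-∀

-- Rational bounds and the limit.

/<⇒ : ∀ m d .{{_ : NonZero d}} q → + m / d ℚ.< q →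
      ∃ λ n → ∃ λ e-1 → + n / suc e-1 ≡ q × m * suc e-1 < n * d
/<⇒ m d@(suc _) q@(mkℚ n e-1 _) m/d<q = numerator n (ℚ.↥p/↧p≡p q)
  (ℚᵘ.drop-*<* (ℚᵘ.≤-<-trans (ℚᵘ.≤-reflexive (ℚᵘ.≃-sym (toℚᵘ-/ m d))) (ℚ.toℚᵘ-mono-< m/d<q)))
  where
  numerator : ∀ n → n / suc e-1 ≡ q → + m ℤ.* + suc e-1 ℤ.< n ℤ.* + d →
              ∃ λ n′ → ∃ λ e-1 → + n′ / suc e-1 ≡ q × m * suc e-1 < n′ * d
  numerator (+ n) n/e≡q lt = n , e-1 , n/e≡q ,
    ℤ.drop‿+<+ (subst₂ ℤ._<_ (sym (ℤ.pos-* m (suc e-1))) (sym (ℤ.pos-* n d)) lt)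
  -- A negative numerator is impossible, since `q` exceeds `m / d ≥ 0`.
  numerator -[1+ n ] _ lt = contradiction (subst (ℤ._< _) (sym (ℤ.pos-* m (suc e-1))) lt) λ ()

-- For a decreasing sequence one term at most `q` bounds all later ones, so single terms suffice.
-- Density supplies the strict gaps that the two cuts require.
lim-≤ : ∀ a decreasing b bounded r → (∀ q → r ℚ.< q → ∃ λ n → a n ℚ.≤ q) →
        Limit.lim a decreasing b bounded ≤ᴿ fromℚ r
lim-≤ a decreasing b bounded r small = below , above
  where
  open Limit a decreasing b bounded
  below : ∀ {p} → lower lim p → p ℚ.< r
  below (p′ , p<p′ , N , p′≤a) = ℚ.<-≤-trans p<p′ (ℚ.≮⇒≥ λ r<p′ →
    let q , r<q , q<p′ = ℚ.<-dense r<p′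
        n , aₙ≤q = small q r<q
    in ℚ.<-irrefl refl (ℚ.<-≤-trans q<p′ (ℚ.≤-trans (p′≤a (N ℕ.⊔ n) (ℕ.m≤m⊔n N n))
         (ℚ.≤-trans (antitone (ℕ.m≤n⊔m N n)) aₙ≤q))))
  above : ∀ {q} → r ℚ.< q → upper lim q
  above r<q =
    let q′ , r<q′ , q′<q = ℚ.<-dense r<q
        n , aₙ≤q′ = small q′ r<q′
    in q′ , q′<q , n , λ m n≤m → ℚ.≤-trans (antitone n≤m) aₙ≤q′

-- The bound for a general homomorphism.

-- The denominator is a separate `d` with an equation, so that it can be spelled differently from
-- the orders.
ℐ≤α[G^ℓ□F]/d : ∀ G F .{{_ : NonZero (order G)}} .{{_ : NonZero (order F)}} (g : Vertex F → Vertex G) →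
               IsHomomorphism F G g → ∀ l d .{{_ : NonZero d}} → d ≡ order F * order G ^ suc l →
               ℐ G ≤ᴿ fromℚ (+ α (G ^□ suc l □ F) / d)
ℐ≤α[G^ℓ□F]/d G F g g-hom l d refl = lim-≤ _ (powerRatio-decreasing G) ℚ.0ℚ (0≤powerRatio G) _ small
  where
  N = order G
  N-suc : suc (pred N) ≡ N
  N-suc = ℕ.suc-pred N
  P : ℕ → Graph
  P m = G ^□ suc (m + l)

  step : ∀ m → order F * (α (P (suc m)) + α (P m)) ≤
               suc (pred N) ^ m * α (P 0 □ F) + order F * (suc (pred N) * α (P m))
  step m = subst
    (λ N → order F * (α (P (suc m)) + α (P m)) ≤ N ^ m * α (P 0 □ F) + order F * (N * α (P m)))
    (sym N-suc) (ℕ.≤-trans (α-□-hom (P m) F G g g-hom)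
    (ℕ.+-monoˡ-≤ (order F * (N * α (P m))) (α-^□-□ G F l m)))

  small : ∀ q → + α (P 0 □ F) / d ℚ.< q → ∃ λ n → powerRatio G (suc n) ℚ.≤ q
  small q r<q =
    let c , b-1 , c/b≡q , lt = /<⇒ (α (P 0 □ F)) d q r<q
        -- Taking `h = N ^ suc l` makes `f * h` equal to `d`, and `N ^ m * h` the order of `P m`.
        m , αb≤ = eventually-≤ (α ∘ P) (order F) (α (P 0 □ F)) (pred N) step (N ^ suc l) (suc b-1) c lt
    in m + l , subst (powerRatio G (suc (m + l)) ℚ.≤_) c/b≡q
         (/-mono-≤ (α (P m)) (order (P m)) c (suc b-1) {{order-^□≢0 G (suc (m + l))}}
           (subst (λ o → α (P m) * suc b-1 ≤ c * o) (order-P m) αb≤))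
    where
    order-P : ∀ m → suc (pred N) ^ m * N ^ suc l ≡ order (P m)
    order-P m = trans (cong₂ (λ x y → x ^ m * y) N-suc (sym (order-^□ G l)))
                    (sym (order-^□-+ G l m))

-- The triangle in the wheel.

triangle : ∀ n → Fin 3 → Vertex (W (suc (suc n)))
triangle n zero             = inj₂ zero
triangle n (suc zero)       = inj₁ zero
triangle n (suc (suc zero)) = inj₁ (suc zero)

triangle-hom : ∀ n → IsHomomorphism (K 3) (W (suc (suc n))) (triangle n)
triangle-hom n zero             zero             0≢0 = contradiction refl 0≢0
triangle-hom n zero             (suc zero)       _   = tt
triangle-hom n zero             (suc (suc zero)) _   = tt
triangle-hom n (suc zero)       zero             _   = tt
triangle-hom n (suc zero)       (suc zero)       1≢1 = contradiction refl 1≢1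
triangle-hom n (suc zero)       (suc (suc zero)) _   = (λ ()) , inj₁ (inj₁ refl)
triangle-hom n (suc (suc zero)) zero             _   = tt
triangle-hom n (suc (suc zero)) (suc zero)       _   = (λ ()) , inj₂ (inj₁ refl)
triangle-hom n (suc (suc zero)) (suc (suc zero)) 2≢2 = contradiction refl 2≢2

corollary1p4 : ∀ (t ℓ : ℕ) → t ≥ 2 → .{{_ : NonZero ℓ}} →
    ℐ (W (suc (2 * t))) ≤ᴿ
    fromℚ ((+ α (W (suc (2 * t)) ^□ ℓ □ K 3) / (3 * (2 * t + 2) ^ ℓ))
    {{3[2t+2]^ℓ≢0 t ℓ}})
-- Matching `t` as a successor exposes two successors in `suc (2 * t)`, so that rim vertices 0 and 1
-- exist for `triangle`.
corollary1p4 t@(suc _) (suc l) _ =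
  ℐ≤α[G^ℓ□F]/d (W (suc (2 * t))) (K 3) (triangle _) (triangle-hom _)
    l (3 * (2 * t + 2) ^ suc l) {{3[2t+2]^ℓ≢0 t (suc l)}}
    -- The wheel has order `suc (2 * t) + 1`, which must be matched with `2 * t + 2`.
    (cong (λ n → 3 * n ^ suc l) (ℕ.+-suc (2 * t) 1))
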